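{- For every integer $n\ge 1$, $$\mathrm{pf}_n(123,213,312)=n(n-1)+1.$$
   Context: A Dyck path of semilength $n$ is a lattice path from $(0,0)$ to $(n,n)$ consisting of $n$ north steps $N=(0,1)$ and $n$ east steps $E=(1,0)$ that never goes below the line $y=x$. A parking function of size $n$ is a Dyck path of semilength $n$ whose $n$ north steps are labeled bijectively by $\{1,\dots,n\}$ so that whenever two north steps are consecutive in the path (one immediately following the other), the label of the later one is larger. For a parking function $p$ of size $n$, $\phi(p)$ is the permutation of $\{1,\dots,n\}$ (in one-line notation) obtained by reading the labels of the north steps in the order they occur along the path. A permutation $\pi$ of $\{1,\dots,n\}$ contains a permutation $\rho$ of $\{1,\dots,m\}$ if there are indices $1\le i_1<\cdots<i_m\le n$ such that $\pi_{i_a}\le\pi_{i_b}$ if and only if $\rho_a\le\rho_b$; otherwise $\pi$ avoids $\rho$. For permutations $\rho_1,\dots,\rho_r$, $\mathrm{pf}_n(\rho_1,\dots,\rho_r)$ denotes the number of parking functions $p$ of size $n$ such that $\phi(p)$ avoids each of $\rho_1,\dots,\rho_r$. -}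

module Defs where

open import Data.Fin.Base using (Fin; _<_; _≤_)
open import Data.Fin.Patterns using (0F; 1F; 2F)
open import Data.Fin.Permutation using (Permutation′; permutation; cast-id; _⟨$⟩ʳ_; _∘ₚ_)
open import Data.Fin.Properties using (_≟_; all?)
open import Data.List.Base using (List; []; _∷_; length; lookup; take)
open import Data.List.Relation.Unary.All using (All)
open import Data.List.Relation.Unary.Linked using (Linked)
open import Data.Nat.Base as ℕ using (ℕ; suc)
open import Data.Product.Base using (Σ; ∃; _×_; _,_; proj₁)
open import Data.Unit.Base using (⊤)
open import Data.Vec.Base as Vec using (Vec; []; _∷_)
open import Function.Bundles using (_⇔_; Inverse; mk⤖)
open import Function.Base using (_∘_)
open import Function.Definitions using (Bijective)
open import Function.Properties.Bijection using (⤖⇒↔)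
open import Level using (0ℓ)
open import Relation.Binary.Bundles using (Setoid)
open import Relation.Binary.PropositionalEquality.Core using (_≡_; sym)
open import Relation.Binary.PropositionalEquality.Properties using (setoid)
import Relation.Binary.Construct.On as On
open import Relation.Nullary.Decidable using (True; toWitness)
open import Relation.Nullary.Negation.Core using (¬_)

-- The labels 1, …, n are represented by the elements 0, …, n - 1 of Fin n,
-- and likewise for the entries and positions of permutations.

data Step (A : Set) : Set where
  N : A → Step A
  E : Step A

-- A lattice path starting at (0,0) in which every north step carries a
-- label in A.
LabelledPath : Set → Set
LabelledPath A = List (Step A)

northLabels : ∀ {A} → LabelledPath A → List A
northLabels []        = []
northLabels (N a ∷ w) = a ∷ northLabels w
northLabels (E   ∷ w) = northLabels w

#N : ∀ {A} → LabelledPath A → ℕ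
#N = length ∘ northLabels

#E : ∀ {A} → LabelledPath A → ℕ
#E []        = 0
#E (N _ ∷ w) = #E w
#E (E   ∷ w) = suc (#E w)

-- After k steps the path is at the point (#E (take k w) , #N (take k w)).
record IsDyckPath {A : Set} (n : ℕ) (w : LabelledPath A) : Set where
  field
    northSteps : #N w ≡ n
    eastSteps  : #E w ≡ n
    neverBelow : ∀ k → #E (take k w) ℕ.≤ #N (take k w)

Increasing : ∀ {n} → Step (Fin n) → Step (Fin n) → Set
Increasing (N i) (N j) = i < j
Increasing (N _) E     = ⊤
Increasing E     _     = ⊤

record ParkingFunction (n : ℕ) : Set where
  field
    path            : LabelledPath (Fin n)
    isDyckPath      : IsDyckPath n path
    labelsBijective : Bijective _≡_ _≡_ (lookup (northLabels path))
    increasing      : Linked Increasing path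

  open IsDyckPath isDyckPath public

φ : ∀ {n} → ParkingFunction n → Permutation′ n
φ p = cast-id (sym northSteps) ∘ₚ ⤖⇒↔ (mk⤖ labelsBijective)
  where open ParkingFunction p

Contains : ∀ {n m} → Permutation′ n → Permutation′ m → Set
Contains {n} {m} π ρ =
  Σ (Fin m → Fin n) λ i →
    (∀ a b → a < b → i a < i b) ×
    (∀ a b → (π ⟨$⟩ʳ i a ≤ π ⟨$⟩ʳ i b) ⇔ (ρ ⟨$⟩ʳ a ≤ ρ ⟨$⟩ʳ b))

Avoids : ∀ {n m} → Permutation′ n → Permutation′ m → Set
Avoids π ρ = ¬ Contains π ρ

AvoidsAll : ∀ {n} → Permutation′ n → List (∃ Permutation′) → Set
AvoidsAll π = All λ (_ , ρ) → Avoids π ρ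

-- Two parking functions are identified when their labelled paths agree:
-- the proofs they carry must not contribute to the count.
PF : ℕ → List (∃ Permutation′) → Setoid 0ℓ 0ℓ
PF n ρs = On.setoid {B = Σ (ParkingFunction n) λ p → AvoidsAll (φ p) ρs}
  (setoid (LabelledPath (Fin n)))
  (ParkingFunction.path ∘ proj₁)

HasCardinality : Setoid 0ℓ 0ℓ → ℕ → Set
HasCardinality S k = Inverse (setoid (Fin k)) S

-- The permutation with one-line notation v, whose inverse has one-line
-- notation w.
oneLine : ∀ {n} (v w : Vec (Fin n) n) →
          {True (all? λ i → Vec.lookup v (Vec.lookup w i) ≟ i)} →
          {True (all? λ i → Vec.lookup w (Vec.lookup v i) ≟ i)} →
          Permutation′ n
oneLine v w {vw} {wv} =
  permutation (Vec.lookup v) (Vec.lookup w) (toWitness vw) (toWitness wv)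

ρ₁₂₃ ρ₂₁₃ ρ₃₁₂ : Permutation′ 3
ρ₁₂₃ = oneLine (0F ∷ 1F ∷ 2F ∷ []) (0F ∷ 1F ∷ 2F ∷ [])
ρ₂₁₃ = oneLine (1F ∷ 0F ∷ 2F ∷ []) (1F ∷ 0F ∷ 2F ∷ [])
ρ₃₁₂ = oneLine (2F ∷ 0F ∷ 1F ∷ []) (1F ∷ 2F ∷ 0F ∷ [])

{-# OPTIONS --safe #-}

-- The patterns 123, 213 and 312 are exactly those whose second entry is below
-- their third, so a permutation avoids all three iff it is strictly decreasing
-- after its first entry.  The label word of such a parking function is its
-- first label k followed by the other labels in decreasing order.  No two of
-- these later north steps are adjacent, so each is followed by an east step,
-- and the path is N_k followed by blocks NE among which a single extra E is
-- inserted.  With n = m + 1 there are m + 1 places for this E, all of which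
-- are allowed when k is not the largest label; when it is, N_k must itself be
-- followed by E, which leaves one place: m (m + 1) + 1 in all.
module Submission where

open import Defs
open import Data.Fin.Base
  using (Fin; zero; suc; _<_; _≤_; toℕ; fromℕ; inject₁; opposite; punchIn; punchOut; cast)
open import Data.Fin.Patterns using (0F; 1F; 2F)
open import Data.Fin.Permutation using (Permutation′; _⟨$⟩ʳ_; _⟨$⟩ˡ_; inverseˡ)
open import Data.Fin.Properties as Fin
  using (_≟_; <-cmp; ≤fromℕ; fromℕ≢inject₁; inject₁-injective; inject₁ℕ<; toℕ-fromℕ; toℕ-inject₁;
         opposite-involutive; punchInᵢ≢i; punchIn-punchOut; punchIn-cancel-≤; cast-is-id; *↔×; +↔⊎)
open import Data.Fin.Relation.Unary.Top using (view; ‵fromℕ; ‵inject₁)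
open import Data.List.Base using (List; []; _∷_; length; lookup; tabulate; take)
open import Data.List.Membership.Propositional using (_∈_)
open import Data.List.Membership.Propositional.Properties
  using (∈-lookup; ∈-tabulate⁺; ∈-tabulate⁻)
open import Data.List.Properties
  using (∷-injectiveˡ; ∷-injectiveʳ; lookup-tabulate;
         tabulate-cong; tabulate-lookup; length-tabulate)
open import Data.List.Relation.Unary.All as All using ([]; _∷_)
open import Data.List.Relation.Unary.AllPairs using (AllPairs; []; _∷_)
open import Data.List.Relation.Unary.AllPairs.Properties using (tabulate⁺-<)
open import Data.List.Relation.Unary.Any using (here; there; index)
open import Data.List.Relation.Unary.Any.Properties using (lookup-index)
open import Data.List.Relation.Unary.Linked as Linked using (Linked; [-]; _∷_)
open import Data.Nat.Base as ℕ using (ℕ; _+_; _*_; _∸_; _≥_; z≤n; s≤s; s<s; s<s⁻¹; s≤s⁻¹)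
import Data.Nat.Properties as ℕ
open import Data.Product.Base using (∃; _×_; _,_)
open import Data.Sum.Base using (_⊎_; inj₁; inj₂)
open import Data.Sum.Function.Propositional using (_⊎-↔_)
open import Data.Unit.Base using (tt)
open import Function.Base using (_∘_; flip)
open import Function.Bundles using (Bijection; Injection; Equivalence; mk⇔; _⇔_)
open import Function.Construct.Composition using (_↔-∘_)
import Function.Construct.Composition as Compose
open import Function.Construct.Identity using (↔-id)
open import Function.Definitions using (Injective; Surjective; Bijective)
open import Function.Properties.Bijection using (Bijection⇒Inverse)
open import Function.Properties.Inverse using (↔⇒↣)
open import Relation.Binary.Definitions using (tri<; tri≈; tri>)
open import Relation.Binary.PropositionalEquality
  using (_≡_; _≢_; refl; sym; trans; cong; cong₂; subst; subst₂; setoid)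
open import Relation.Nullary using (¬_; yes; no; contradiction)

private
  variable
    A : Set
    m n : ℕ

-- Occurrences of the three patterns.

StrictlyIncreasing StrictlyDecreasing : (Fin m → Fin n) → Set
StrictlyIncreasing f = ∀ a b → a < b → f a < f b
StrictlyDecreasing f = ∀ {i j} → i < j → f j < f i

strictlyIncreasing₃ : (f : Fin 3 → Fin n) → f 0F < f 1F → f 1F < f 2F → StrictlyIncreasing f
strictlyIncreasing₃ f p q 0F 1F _ = p
strictlyIncreasing₃ f p q 0F 2F _ = Fin.<-trans p q
strictlyIncreasing₃ f p q 1F 2F _ = q
strictlyIncreasing₃ f p q 1F 1F (s≤s ())
strictlyIncreasing₃ f p q 2F 1F (s≤s ())
strictlyIncreasing₃ f p q 2F 2F (s≤s (s≤s ()))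

strictlyIncreasing⇒≤⇔≤ : {f : Fin m → Fin n} → StrictlyIncreasing f →
                          ∀ a b → (f a ≤ f b) ⇔ (a ≤ b)
strictlyIncreasing⇒≤⇔≤ {f = f} mono a b = mk⇔ reflects preserves
  where
  reflects : f a ≤ f b → a ≤ b
  reflects fa≤fb = ℕ.≮⇒≥ (λ b<a → ℕ.<⇒≱ (mono b a b<a) fa≤fb)

  preserves : a ≤ b → f a ≤ f b
  preserves a≤b with <-cmp a b
  ... | tri< a<b _ _ = ℕ.<⇒≤ (mono a b a<b)
  ... | tri≈ _ refl _ = ℕ.≤-refl
  ... | tri> _ _ b<a = contradiction a≤b (ℕ.<⇒≱ b<a)

-- Visiting the chosen positions in the order of their `ρ`-values turns the order isomorphism into
-- monotonicity; evaluating at `ρ ⟨$⟩ʳ a` and `ρ ⟨$⟩ʳ b` and cancelling the inverse recovers the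
-- equivalence.
contains : (π : Permutation′ n) (ρ : Permutation′ m) (i : Fin m → Fin n) →
           StrictlyIncreasing i → StrictlyIncreasing (λ x → π ⟨$⟩ʳ i (ρ ⟨$⟩ˡ x)) →
           Contains π ρ
contains π ρ i i↑ πiρ⁻¹↑ = i , i↑ , λ a b →
  subst₂ (λ a′ b′ → (π ⟨$⟩ʳ i a′ ≤ π ⟨$⟩ʳ i b′) ⇔ (ρ ⟨$⟩ʳ a ≤ ρ ⟨$⟩ʳ b)) (inverseˡ ρ) (inverseˡ ρ)
    (strictlyIncreasing⇒≤⇔≤ πiρ⁻¹↑ (ρ ⟨$⟩ʳ a) (ρ ⟨$⟩ʳ b))

patterns : List (∃ Permutation′)
patterns = (3 , ρ₁₂₃) ∷ (3 , ρ₂₁₃) ∷ (3 , ρ₃₁₂) ∷ []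

-- An ascent after the first entry forms a pattern with that entry: 123, 213 or 312 according as the
-- first value lies below, between or above the two values of the ascent.
avoids⇒decreasing : (π : Permutation′ (ℕ.suc m)) → AvoidsAll π patterns →
                     StrictlyDecreasing (λ i → π ⟨$⟩ʳ suc i)
avoids⇒decreasing {m} π (¬123 ∷ ¬213 ∷ ¬312 ∷ []) {i} {j} i<j = descent
  where
  triple : Fin 3 → Fin (ℕ.suc m)
  triple 0F = zero
  triple 1F = suc i
  triple 2F = suc j

  triple↑ : StrictlyIncreasing triple
  triple↑ = strictlyIncreasing₃ triple (s≤s z≤n) (s<s i<j)

  π-injective : Injective _≡_ _≡_ (π ⟨$⟩ʳ_)
  π-injective = Injection.injective (↔⇒↣ π)

  occurs : (ρ : Permutation′ 3) → let f = λ x → π ⟨$⟩ʳ triple (ρ ⟨$⟩ˡ x) in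
           f 0F < f 1F → f 1F < f 2F → Contains π ρ
  occurs ρ p q = contains π ρ triple triple↑ (strictlyIncreasing₃ _ p q)

  descent : π ⟨$⟩ʳ suc j < π ⟨$⟩ʳ suc i
  descent with <-cmp (π ⟨$⟩ʳ suc i) (π ⟨$⟩ʳ suc j)
  ... | tri> _ _ πj<πi = πj<πi
  ... | tri≈ _ πi≡πj _ = contradiction (Fin.suc-injective (π-injective πi≡πj)) (Fin.<⇒≢ i<j)
  ... | tri< πi<πj _ _ with <-cmp (π ⟨$⟩ʳ zero) (π ⟨$⟩ʳ suc i)
  ... | tri< π0<πi _ _ = contradiction (occurs ρ₁₂₃ π0<πi πi<πj) ¬123
  ... | tri≈ _ π0≡πi _ = contradiction (π-injective π0≡πi) λ ()
  ... | tri> _ _ πi<π0 with <-cmp (π ⟨$⟩ʳ zero) (π ⟨$⟩ʳ suc j)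
  ... | tri< π0<πj _ _ = contradiction (occurs ρ₂₁₃ πi<π0 π0<πj) ¬213
  ... | tri≈ _ π0≡πj _ = contradiction (π-injective π0≡πj) λ ()
  ... | tri> _ _ πj<π0 = contradiction (occurs ρ₃₁₂ πi<πj πj<π0) ¬312

-- The last two entries of an occurrence sit beyond the first position, where `π` descends, while
-- each pattern ascends there.
decreasing⇒avoids : (π : Permutation′ (ℕ.suc m)) → StrictlyDecreasing (λ i → π ⟨$⟩ʳ suc i) →
                     AvoidsAll π patterns
decreasing⇒avoids π π↓ =
  avoids ρ₁₂₃ (s≤s z≤n) ∷ avoids ρ₂₁₃ z≤n ∷ avoids ρ₃₁₂ z≤n ∷ []
  where
  descent : ∀ {a b c} → a < b → b < c → π ⟨$⟩ʳ c < π ⟨$⟩ʳ b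
  -- Having an index below them makes `b` and `c` successors.
  descent {b = suc b} {suc c} _ b<c = π↓ (s<s⁻¹ b<c)

  avoids : (ρ : Permutation′ 3) → ρ ⟨$⟩ʳ 1F ≤ ρ ⟨$⟩ʳ 2F → Avoids π ρ
  avoids ρ ρ₁≤ρ₂ (i , i↑ , iso) =
    ℕ.<⇒≱ (descent (i↑ 0F 1F (s≤s z≤n)) (i↑ 1F 2F (s≤s (s≤s z≤n))))
          (Equivalence.from (iso 1F 2F) ρ₁≤ρ₂)

-- Label words: a first label and the rest in decreasing order.

others : Fin (ℕ.suc m) → Fin m → Fin (ℕ.suc m)
others k = punchIn k ∘ opposite

opposite-decreasing : StrictlyDecreasing (opposite {n})
opposite-decreasing {ℕ.suc n} {zero} {suc j} _ =
  subst (toℕ (inject₁ (opposite j)) ℕ.<_) (sym (toℕ-fromℕ n)) (inject₁ℕ< (opposite j))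
opposite-decreasing {ℕ.suc n} {suc i} {suc j} i<j =
  subst₂ ℕ._<_ (sym (toℕ-inject₁ (opposite j))) (sym (toℕ-inject₁ (opposite i)))
    (opposite-decreasing (s<s⁻¹ i<j))

-- `opposite` reverses the order and `punchIn k` reflects it.
others-decreasing : (k : Fin (ℕ.suc m)) → StrictlyDecreasing (others k)
others-decreasing k i<j = ℕ.≰⇒> λ le →
  ℕ.<⇒≱ (opposite-decreasing i<j) (punchIn-cancel-≤ k _ _ le)

∈-others⁺ : {k x : Fin (ℕ.suc m)} → k ≢ x → x ∈ tabulate (others k)
∈-others⁺ {k = k} {x} k≢x =
  subst (_∈ tabulate (others k)) eq (∈-tabulate⁺ (opposite (punchOut k≢x)))
  where
  eq : others k (opposite (punchOut k≢x)) ≡ x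
  eq = trans (cong (punchIn k) (opposite-involutive _)) (punchIn-punchOut k≢x)

∈-others⁻ : {k x : Fin (ℕ.suc m)} → x ∈ tabulate (others k) → k ≢ x
∈-others⁻ {k = k} x∈ refl with i , k≡ ← ∈-tabulate⁻ x∈ = punchInᵢ≢i k (opposite i) (sym k≡)

-- The right-hand side is `others (inject₁ k) zero`, the label of the second north step, so a
-- non-maximal first label may be directly followed by it.
inject₁<punchIn-top : (k : Fin (ℕ.suc m)) → inject₁ k < punchIn (inject₁ k) (fromℕ m)
inject₁<punchIn-top zero = s≤s z≤n
inject₁<punchIn-top {ℕ.suc m} (suc k) = s<s (inject₁<punchIn-top k)

-- Each head is the maximum of its list, so mutual inclusion makes the heads agree; the tails still
-- include one another because their entries lie strictly below that common head.
decreasing-ext : {xs ys : List (Fin n)} →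
                 AllPairs (flip _<_) xs → AllPairs (flip _<_) ys →
                 (∀ {x} → x ∈ xs → x ∈ ys) → (∀ {x} → x ∈ ys → x ∈ xs) → xs ≡ ys
decreasing-ext {xs = []} {[]} _ _ _ _ = refl
decreasing-ext {xs = []} {y ∷ ys} _ _ _ ⊇ with () ← ⊇ (here refl)
decreasing-ext {xs = x ∷ xs} {[]} _ _ ⊆ _ with () ← ⊆ (here refl)
decreasing-ext {xs = x ∷ xs} {y ∷ ys} (x> ∷ xs↓) (y> ∷ ys↓) ⊆ ⊇ =
  cong₂ _∷_ x≡y (decreasing-ext xs↓ ys↓
    (λ z∈ → drop-head (λ z≡y → Fin.<⇒≢ (All.lookup x> z∈) (trans z≡y (sym x≡y))) (⊆ (there z∈)))
    (λ z∈ → drop-head (λ z≡x → Fin.<⇒≢ (All.lookup y> z∈) (trans z≡x x≡y)) (⊇ (there z∈))))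
  where
  drop-head : ∀ {z w} {ws : List (Fin _)} → z ≢ w → z ∈ w ∷ ws → z ∈ ws
  drop-head z≢w (here z≡w) = contradiction z≡w z≢w
  drop-head z≢w (there z∈) = z∈

  x≡y : x ≡ y
  x≡y with ⊆ (here refl) | ⊇ (here refl)
  ... | here x≡y | _ = x≡y
  ... | there _ | here y≡x = sym y≡x
  ... | there x∈ | there y∈ = contradiction (All.lookup y> x∈) (Fin.<-asym (All.lookup x> y∈))

tabulate-lookup-cast : (xs : List A) (eq : m ≡ length xs) → tabulate (lookup xs ∘ cast eq) ≡ xs
tabulate-lookup-cast xs refl =
  trans (tabulate-cong (λ i → cong (lookup xs) (cast-is-id refl i))) (tabulate-lookup xs)

-- Injectivity keeps `k` out of the tail and surjectivity puts every other label into it, so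
-- `decreasing-ext` applies. The `cast eq` mirrors the one in `φ`, so that facts about `φ p` fit by
-- computation.
decreasing⇒labels : (l : List (Fin (ℕ.suc m))) (eq : ℕ.suc m ≡ length l) →
  Bijective _≡_ _≡_ (lookup l) → StrictlyDecreasing (λ i → lookup l (cast eq (suc i))) →
  ∃ λ k → l ≡ k ∷ tabulate (others k)
decreasing⇒labels (k ∷ t) eq (inj , surj) l↓ =
  k , cong (k ∷_) (decreasing-ext t↓ (tabulate⁺-< (others-decreasing k))
                     (∈-others⁺ ∘ ∈t⇒≢k) (≢k⇒∈t ∘ ∈-others⁻))
  where
  t↓ : AllPairs (flip _<_) t
  t↓ = subst (AllPairs (flip _<_)) (tabulate-lookup-cast t (ℕ.suc-injective eq)) (tabulate⁺-< l↓)

  ∈t⇒≢k : ∀ {x} → x ∈ t → k ≢ x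
  ∈t⇒≢k x∈t k≡x with () ← inj {zero} {suc (index x∈t)} (trans k≡x (lookup-index x∈t))

  ≢k⇒∈t : ∀ {x} → k ≢ x → x ∈ t
  ≢k⇒∈t {x} k≢x with surj x
  ... | zero , eq′ = contradiction (eq′ refl) k≢x
  ... | suc i , eq′ = subst (_∈ t) (eq′ refl) (∈-lookup i)

labels⇒decreasing : {l : List (Fin (ℕ.suc m))} {k : Fin (ℕ.suc m)} (eq : ℕ.suc m ≡ length l) →
  l ≡ k ∷ tabulate (others k) → StrictlyDecreasing (λ i → lookup l (cast eq (suc i)))
labels⇒decreasing {k = k} eq refl {i} {j} i<j =
  subst₂ _<_ (sym (lookup-tabulate (others k) j)) (sym (lookup-tabulate (others k) i))
    (others-decreasing k i<j)

decreasing⇒lookup-injective : {xs : List (Fin n)} → AllPairs (flip _<_) xs →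
  Injective _≡_ _≡_ (lookup xs)
decreasing⇒lookup-injective (x> ∷ xs↓) {zero} {zero} _ = refl
decreasing⇒lookup-injective (x> ∷ xs↓) {zero} {suc j} eq =
  contradiction (sym eq) (Fin.<⇒≢ (All.lookup x> (∈-lookup j)))
decreasing⇒lookup-injective (x> ∷ xs↓) {suc i} {zero} eq =
  contradiction eq (Fin.<⇒≢ (All.lookup x> (∈-lookup i)))
decreasing⇒lookup-injective (x> ∷ xs↓) {suc i} {suc j} eq =
  cong suc (decreasing⇒lookup-injective xs↓ eq)

labels-bijective : {l : List (Fin (ℕ.suc m))} {k : Fin (ℕ.suc m)} →
  l ≡ k ∷ tabulate (others k) → Bijective _≡_ _≡_ (lookup l)
labels-bijective {k = k} refl = inj , surj
  where
  lookup-suc≢ : ∀ i → k ≢ lookup (tabulate (others k)) i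
  lookup-suc≢ i = ∈-others⁻ (∈-lookup i)

  inj : Injective _≡_ _≡_ (lookup (k ∷ tabulate (others k)))
  inj {zero} {zero} _ = refl
  inj {zero} {suc j} eq = contradiction eq (lookup-suc≢ j)
  inj {suc i} {zero} eq = contradiction (sym eq) (lookup-suc≢ i)
  inj {suc i} {suc j} eq =
    cong suc (decreasing⇒lookup-injective (tabulate⁺-< (others-decreasing k)) eq)

  surj : Surjective _≡_ _≡_ (lookup (k ∷ tabulate (others k)))
  surj x with k ≟ x
  ... | yes k≡x = zero , λ { refl → k≡x }
  ... | no k≢x = suc (index x∈) , λ { refl → sym (lookup-index x∈) }
    where x∈ = ∈-others⁺ k≢x

-- Paths built from blocks NE.

blocks : (Fin m → A) → LabelledPath A
blocks {m = ℕ.zero} f = []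
blocks {m = ℕ.suc m} f = N (f zero) ∷ E ∷ blocks (f ∘ suc)

-- The index is the number of blocks before the extra E.
blocksWithE : Fin (ℕ.suc m) → (Fin m → A) → LabelledPath A
blocksWithE zero f = E ∷ blocks f
blocksWithE {m = ℕ.suc m} (suc c) f = N (f zero) ∷ E ∷ blocksWithE c (f ∘ suc)

-- The Dyck condition for the rest of a path from a point `h` units above the diagonal: `h` is 1
-- after the first north step and 0 once the extra E is spent.
WeaklyAbove : ℕ → LabelledPath A → Set
WeaklyAbove h w = ∀ k → #E (take k w) ℕ.≤ h + #N (take k w)

northLabels-blocks : (f : Fin m → A) → northLabels (blocks f) ≡ tabulate f
northLabels-blocks {m = ℕ.zero} f = refl
northLabels-blocks {m = ℕ.suc m} f = cong (f zero ∷_) (northLabels-blocks (f ∘ suc))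

northLabels-blocksWithE : ∀ c (f : Fin m → A) → northLabels (blocksWithE c f) ≡ tabulate f
northLabels-blocksWithE zero f = northLabels-blocks f
northLabels-blocksWithE {m = ℕ.suc m} (suc c) f =
  cong (f zero ∷_) (northLabels-blocksWithE c (f ∘ suc))

#E-blocks : (f : Fin m → A) → #E (blocks f) ≡ m
#E-blocks {m = ℕ.zero} f = refl
#E-blocks {m = ℕ.suc m} f = cong ℕ.suc (#E-blocks (f ∘ suc))

#E-blocksWithE : ∀ c (f : Fin m → A) → #E (blocksWithE c f) ≡ ℕ.suc m
#E-blocksWithE zero f = cong ℕ.suc (#E-blocks f)
#E-blocksWithE {m = ℕ.suc m} (suc c) f = cong ℕ.suc (#E-blocksWithE c (f ∘ suc))

blocks-above : (f : Fin m → A) → WeaklyAbove 0 (blocks f)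
blocks-above {m = ℕ.zero} f ℕ.zero = z≤n
blocks-above {m = ℕ.zero} f (ℕ.suc k) = z≤n
blocks-above {m = ℕ.suc m} f ℕ.zero = z≤n
blocks-above {m = ℕ.suc m} f (ℕ.suc ℕ.zero) = z≤n
blocks-above {m = ℕ.suc m} f (ℕ.suc (ℕ.suc k)) = s≤s (blocks-above (f ∘ suc) k)

blocksWithE-above : ∀ c (f : Fin m → A) → WeaklyAbove 1 (blocksWithE c f)
blocksWithE-above zero f ℕ.zero = z≤n
blocksWithE-above zero f (ℕ.suc k) = s≤s (blocks-above f k)
blocksWithE-above {m = ℕ.suc m} (suc c) f ℕ.zero = z≤n
blocksWithE-above {m = ℕ.suc m} (suc c) f (ℕ.suc ℕ.zero) = z≤n
blocksWithE-above {m = ℕ.suc m} (suc c) f (ℕ.suc (ℕ.suc k)) =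
  s≤s (blocksWithE-above c (f ∘ suc) k)

-- The leading E is the end of the preceding block; including it lets the induction cover the
-- junctions between blocks.
blocks-increasing : (f : Fin m → Fin n) → Linked Increasing (E ∷ blocks f)
blocks-increasing {ℕ.zero} f = [-]
blocks-increasing {ℕ.suc m} f = tt ∷ tt ∷ blocks-increasing (f ∘ suc)

blocksWithE-increasing : ∀ c (f : Fin m → Fin n) → Linked Increasing (E ∷ blocksWithE c f)
blocksWithE-increasing zero f = tt ∷ blocks-increasing f
blocksWithE-increasing {ℕ.suc m} (suc c) f = tt ∷ tt ∷ blocksWithE-increasing c (f ∘ suc)

blocksWithE-injective : ∀ c d {f : Fin m → A} → blocksWithE c f ≡ blocksWithE d f → c ≡ d
blocksWithE-injective zero zero _ = refl
blocksWithE-injective {ℕ.suc m} zero (suc d) ()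
blocksWithE-injective {ℕ.suc m} (suc c) zero ()
blocksWithE-injective {ℕ.suc m} (suc c) (suc d) eq =
  cong suc (blocksWithE-injective c d (∷-injectiveʳ (∷-injectiveʳ eq)))

-- Recovering a path from its label word.

N-injective : {a b : A} → N a ≡ N b → a ≡ b
N-injective refl = refl

¬adjacentNorths : {f : Fin m → Fin n} → StrictlyDecreasing f → ∀ {a b w} →
  a ∷ b ∷ northLabels w ≡ tabulate f → ¬ Linked Increasing (N a ∷ N b ∷ w)
¬adjacentNorths {ℕ.suc (ℕ.suc m)} f↓ eq (a<b ∷ _)
  with refl ← ∷-injectiveˡ eq | refl ← ∷-injectiveˡ (∷-injectiveʳ eq) =
  Fin.<-asym a<b (f↓ (s≤s z≤n))

-- On the diagonal the next step must be N, the descending labels force an E after it, and the path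
-- is back on the diagonal.
≡-blocks : {f : Fin m → Fin n} → StrictlyDecreasing f → ∀ w →
  northLabels w ≡ tabulate f → #E w ≡ m → WeaklyAbove 0 w → Linked Increasing w → w ≡ blocks f
≡-blocks {ℕ.zero} f↓ [] labels es above inc = refl
≡-blocks f↓ (E ∷ w) labels es above inc with () ← above 1
≡-blocks {ℕ.suc m} f↓ (N a ∷ []) labels () above inc
≡-blocks f↓ (N a ∷ N b ∷ w) labels es above inc =
  contradiction inc (¬adjacentNorths f↓ labels)
≡-blocks {ℕ.suc m} f↓ (N a ∷ E ∷ w) labels es above inc =
  cong₂ (λ x w → N x ∷ E ∷ w) (∷-injectiveˡ labels)
    (≡-blocks (f↓ ∘ s<s) w (∷-injectiveʳ labels) (ℕ.suc-injective es)
      (λ k → s≤s⁻¹ (above (2 + k))) (Linked.tail (Linked.tail inc)))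

-- One unit above the diagonal, a step E is the extra one and leaves a path covered by `≡-blocks`; a
-- step N starts a block that returns to the same height. The count of east steps ensures that the
-- extra E occurs.
≡-blocksWithE : {f : Fin m → Fin n} → StrictlyDecreasing f → ∀ w →
  northLabels w ≡ tabulate f → #E w ≡ ℕ.suc m → WeaklyAbove 1 w → Linked Increasing w →
  ∃ λ c → w ≡ blocksWithE c f
≡-blocksWithE f↓ (E ∷ w) labels es above inc =
  zero , cong (E ∷_) (≡-blocks f↓ w labels (ℕ.suc-injective es)
    (λ k → s≤s⁻¹ (above (1 + k))) (Linked.tail inc))
≡-blocksWithE f↓ (N a ∷ N b ∷ w) labels es above inc =
  contradiction inc (¬adjacentNorths f↓ labels)
≡-blocksWithE {ℕ.suc m} f↓ (N a ∷ E ∷ w) labels es above inc =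
  let c , w≡ = ≡-blocksWithE (f↓ ∘ s<s) w (∷-injectiveʳ labels) (ℕ.suc-injective es)
                 (λ k → s≤s⁻¹ (above (2 + k))) (Linked.tail (Linked.tail inc))
  in  suc c , cong₂ (λ x w → N x ∷ E ∷ w) (∷-injectiveˡ labels) w≡

-- Encoding and counting.

shape : Fin (ℕ.suc m) → Fin (ℕ.suc m) → LabelledPath (Fin (ℕ.suc m))
shape k c = N k ∷ blocksWithE c (others k)

northLabels-shape : (k c : Fin (ℕ.suc m)) → northLabels (shape k c) ≡ k ∷ tabulate (others k)
northLabels-shape k c = cong (k ∷_) (northLabels-blocksWithE c (others k))

shape-isDyckPath : (k c : Fin (ℕ.suc m)) → IsDyckPath (ℕ.suc m) (shape k c)
shape-isDyckPath k c = record
  { northSteps = trans (cong length (northLabels-shape k c)) (cong ℕ.suc (length-tabulate (others k)))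
  ; eastSteps  = #E-blocksWithE c (others k)
  ; neverBelow = λ { ℕ.zero → z≤n ; (ℕ.suc j) → blocksWithE-above c (others k) j }
  }

-- Either a place for the extra E with a non-maximal first label, or the single path whose first
-- label is maximal. The factors are ordered as in `n * (n ∸ 1) + 1` for `n = suc m`.
Code : ℕ → Set
Code m = (Fin (ℕ.suc m) × Fin m) ⊎ Fin 1

firstLabel extraE : Code m → Fin (ℕ.suc m)
firstLabel (inj₁ (c , k)) = inject₁ k
firstLabel {m} (inj₂ _) = fromℕ m
extraE (inj₁ (c , k)) = c
-- The maximal label needs the extra E right after it.
extraE (inj₂ _) = zero

codePath : Code m → LabelledPath (Fin (ℕ.suc m))
codePath x = shape (firstLabel x) (extraE x)

codePath-labels : (x : Code m) →
  northLabels (codePath x) ≡ firstLabel x ∷ tabulate (others (firstLabel x))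
codePath-labels x = northLabels-shape (firstLabel x) (extraE x)

-- Two north steps can be adjacent only at the start, when a block precedes the extra E.
codePath-increasing : (x : Code m) → Linked Increasing (codePath x)
codePath-increasing (inj₁ (zero , k)) = tt ∷ blocks-increasing (others (inject₁ k))
codePath-increasing {ℕ.suc m} (inj₁ (suc c , k)) =
  inject₁<punchIn-top k ∷ tt ∷ blocksWithE-increasing c (others (inject₁ k) ∘ suc)
codePath-increasing (inj₂ _) = tt ∷ blocks-increasing (others (fromℕ _))

codeParkingFunction : Code m → ParkingFunction (ℕ.suc m)
codeParkingFunction x = record
  { path            = codePath x
  ; isDyckPath      = shape-isDyckPath (firstLabel x) (extraE x)
  ; labelsBijective = labels-bijective (codePath-labels x)
  ; increasing      = codePath-increasing x
  }

code-avoids : (x : Code m) → AvoidsAll (φ (codeParkingFunction x)) patterns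
code-avoids x = decreasing⇒avoids (φ p) (labels⇒decreasing (sym northSteps) (codePath-labels x))
  where
  p = codeParkingFunction x
  open ParkingFunction p

codePath-injective : Injective _≡_ _≡_ (codePath {m})
codePath-injective {x = inj₁ (c , k)} {inj₁ (d , l)} eq
  with refl ← inject₁-injective {i = k} {l} (N-injective (∷-injectiveˡ eq))
  with refl ← blocksWithE-injective c d (∷-injectiveʳ eq) = refl
codePath-injective {x = inj₁ _} {inj₂ _} eq =
  contradiction (sym (N-injective (∷-injectiveˡ eq))) fromℕ≢inject₁
codePath-injective {x = inj₂ _} {inj₁ _} eq =
  contradiction (N-injective (∷-injectiveˡ eq)) fromℕ≢inject₁
codePath-injective {x = inj₂ zero} {inj₂ zero} eq = refl

-- When k is the largest label it cannot be adjacent to the next north step.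
shape⇒code : (k c : Fin (ℕ.suc m)) → Linked Increasing (shape k c) →
             ∃ λ x → codePath x ≡ shape k c
shape⇒code k c inc with view k
shape⇒code _ c _ | ‵inject₁ k = inj₁ (c , k) , refl
shape⇒code _ zero _ | ‵fromℕ = inj₂ zero , refl
shape⇒code {ℕ.suc m} _ (suc c) (top<next ∷ _) | ‵fromℕ =
  contradiction (≤fromℕ (others (fromℕ (ℕ.suc m)) zero)) (ℕ.<⇒≱ top<next)

labels⇒shape : (w : LabelledPath (Fin (ℕ.suc m))) {k : Fin (ℕ.suc m)} →
  IsDyckPath (ℕ.suc m) w → Linked Increasing w → northLabels w ≡ k ∷ tabulate (others k) →
  ∃ λ c → w ≡ shape k c
labels⇒shape (E ∷ w) dyck inc labels with () ← IsDyckPath.neverBelow dyck 1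
labels⇒shape (N a ∷ w) {k} dyck inc labels =
  let c , w≡ = ≡-blocksWithE (others-decreasing k) w (∷-injectiveʳ labels) eastSteps
                 -- The initial N supplies the unit of height in `WeaklyAbove 1`.
                 (neverBelow ∘ ℕ.suc) (Linked.tail inc)
  in  c , cong₂ (λ x w → N x ∷ w) (∷-injectiveˡ labels) w≡
  where open IsDyckPath dyck

parkingFunction⇒code : (p : ParkingFunction (ℕ.suc m)) → AvoidsAll (φ p) patterns →
                        ∃ λ x → codePath x ≡ ParkingFunction.path p
parkingFunction⇒code p avoids =
  let k , labels = decreasing⇒labels (northLabels path) (sym northSteps) labelsBijective
                     (avoids⇒decreasing (φ p) avoids)
      c , path≡  = labels⇒shape path isDyckPath increasing labels
      x , code≡  = shape⇒code k c (subst (Linked Increasing) path≡ increasing)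
  in  x , trans code≡ (sym path≡)
  where open ParkingFunction p

-- Equality in `PF` is equality of paths, so bijectivity is a statement about `codePath`.
codeBijection : Bijection (setoid (Code m)) (PF (ℕ.suc m) patterns)
codeBijection = record
  { to        = λ x → codeParkingFunction x , code-avoids x
  ; cong      = cong codePath
  ; bijective = codePath-injective , λ (p , avoids) →
      let x , x≡ = parkingFunction⇒code p avoids in x , λ { refl → x≡ }
  }

theorem10 : (n : ℕ) → n ≥ 1 →
    HasCardinality (PF n ((3 , ρ₁₂₃) ∷ (3 , ρ₂₁₃) ∷ (3 , ρ₃₁₂) ∷ [])) (n * (n ∸ 1) + 1)
theorem10 (ℕ.suc m) _ =
  -- Splitting the sum and then the product identifies the finite set with `Code m`.
  Compose.inverse (((*↔× {ℕ.suc m} {m}) ⊎-↔ ↔-id (Fin 1)) ↔-∘ +↔⊎) (Bijection⇒Inverse codeBijection)
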